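{- $$\sum_{\pi\in\mathcal{DS}^3}x^{|\pi_o|}y^{|\pi_e|}s^{o_1(\pi)}t^{o_2(\pi)}u^{e_1(\pi)}v^{e_2(\pi)}=\frac{(-sx-tx^2,\,-ux^3y-vx^3y^2;\,x^3y^3)_\infty}{(x^3;x^3y^3)_\infty}.$$
   Context: $\mathcal{DS}^3$ is the set of partitions into distinct parts in which, for no integer $l\ge0$, both $3l+1$ and $3l+2$ are parts. For a partition $\pi=(\pi_1>\pi_2>\cdots)$, $|\pi_o|$ (resp. $|\pi_e|$) is the sum of the odd-indexed parts $\pi_1,\pi_3,\dots$ (resp. even-indexed parts $\pi_2,\pi_4,\dots$); for $i=1,2$, $o_i(\pi)$ (resp. $e_i(\pi)$) is the number of odd-indexed (resp. even-indexed) parts that are $\equiv i\pmod 3$. $(a,b;q)_\infty=\prod_{i\ge1}(1-aq^{i-1})(1-bq^{i-1})$. -}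

module Defs where

open import Data.Nat as ℕ using (ℕ; zero; suc; _%_)
open import Data.Integer as ℤ using (ℤ; +_; -_)
open import Data.Product using (_×_; _,_)
open import Data.Product.Properties using (≡-dec)
open import Data.List using (List; []; _∷_; length; filter; concatMap; map; upTo; foldr)
open import Data.Nat.ListAction using (sum)
open import Data.Bool.ListAction using (any)
open import Data.List.Relation.Unary.All using (All)
open import Data.List.Relation.Unary.Linked using (Linked)
open import Data.List.Membership.Propositional using (_∈_)
open import Data.Bool using (Bool; true; false; if_then_else_)
open import Relation.Nullary using (¬_; Dec; yes; no)
open import Relation.Nullary.Decidable using (⌊_⌋)
open import Relation.Binary.PropositionalEquality using (_≡_)

Partition : Set
Partition = List ℕ

IsDistinctPartition : Partition → Set
IsDistinctPartition π = Linked ℕ._>_ π × All (0 ℕ.<_) π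

DS3 : Partition → Set
DS3 π = IsDistinctPartition π × ((l : ℕ) → ¬ ((ℕ.suc (3 ℕ.* l) ∈ π) × (2 ℕ.+ 3 ℕ.* l ∈ π)))

mutual
  oddParts : Partition → List ℕ
  oddParts []      = []
  oddParts (p ∷ r) = p ∷ evenParts r

  evenParts : Partition → List ℕ
  evenParts []      = []
  evenParts (p ∷ r) = oddParts r

countMod3 : ℕ → List ℕ → ℕ
countMod3 i xs = length (filter (λ p → p % 3 ℕ.≟ i) xs)

-- Monomials x^a y^b s^c t^d u^e v^f, as exponent 6-tuples (a,b,c,d,e,f).

Mono : Set
Mono = ℕ × ℕ × ℕ × ℕ × ℕ × ℕ

_≟M_ : (m n : Mono) → Dec (m ≡ n)
_≟M_ = ≡-dec ℕ._≟_ (≡-dec ℕ._≟_ (≡-dec ℕ._≟_ (≡-dec ℕ._≟_ (≡-dec ℕ._≟_ ℕ._≟_))))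

stats : Partition → Mono
stats π = sum (oddParts π) , sum (evenParts π)
        , countMod3 1 (oddParts π) , countMod3 2 (oddParts π)
        , countMod3 1 (evenParts π) , countMod3 2 (evenParts π)

_·M_ : Mono → Mono → Mono
(a , b , c , d , e , f) ·M (a' , b' , c' , d' , e' , f') =
  (a ℕ.+ a' , b ℕ.+ b' , c ℕ.+ c' , d ℕ.+ d' , e ℕ.+ e' , f ℕ.+ f')

oneM : Mono
oneM = 0 , 0 , 0 , 0 , 0 , 0

_^M_ : Mono → ℕ → Mono
m ^M zero  = oneM
m ^M suc k = m ·M (m ^M k)

_∸M_ : Mono → Mono → Mono
(a , b , c , d , e , f) ∸M (a' , b' , c' , d' , e' , f') =
  (a ℕ.∸ a' , b ℕ.∸ b' , c ℕ.∸ c' , d ℕ.∸ d' , e ℕ.∸ e' , f ℕ.∸ f')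

range : ℕ → List ℕ
range n = upTo (suc n)

divisors : Mono → List Mono
divisors (a , b , c , d , e , f) =
  concatMap (λ a' → concatMap (λ b' → concatMap (λ c' → concatMap (λ d' →
    concatMap (λ e' → map (λ f' → (a' , b' , c' , d' , e' , f')) (range f))
      (range e)) (range d)) (range c)) (range b)) (range a)

totalDeg : Mono → ℕ
totalDeg (a , b , c , d , e , f) = a ℕ.+ b ℕ.+ c ℕ.+ d ℕ.+ e ℕ.+ f

Series : Set
Series = Mono → ℤ

term : ℤ → Mono → Series
term c m n with m ≟M n
... | yes _ = c
... | no  _ = + 0

one : Series
one = term (+ 1) oneM

_⊖_ : Series → Series → Series
(f ⊖ g) m = f m ℤ.- g m

_⊛_ : Series → Series → Series
(f ⊛ g) m = foldr ℤ._+_ (+ 0) (map (λ d → f d ℤ.* g (m ∸M d)) (divisors m))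

prodBelow : ℕ → (ℕ → Series) → Series
prodBelow zero    F = one
prodBelow (suc n) F = prodBelow n F ⊛ F n

-- 1/(1-m) = Σ_{k≥0} m^k   (used only for monomials m ≠ 1)
geom : Mono → Series
geom m n = if any (λ k → ⌊ (m ^M k) ≟M n ⌋) (range (totalDeg n)) then + 1 else + 0

_⊕_ : Series → Series → Series
(f ⊕ g) m = f m ℤ.+ g m

neg : Series → Series
neg f m = ℤ.- f m

poch : Series → Mono → ℕ → Series
poch a q N = prodBelow N (λ i → one ⊖ (a ⊛ term (+ 1) (q ^M i)))

invPoch : Mono → Mono → ℕ → Series
invPoch m q N = prodBelow N (λ i → geom (m ·M (q ^M i)))

X³Y³ X³ SX TX² UX³Y VX³Y² : Mono
X³Y³  = 3 , 3 , 0 , 0 , 0 , 0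
X³    = 3 , 0 , 0 , 0 , 0 , 0
SX    = 1 , 0 , 1 , 0 , 0 , 0
TX²   = 2 , 0 , 0 , 1 , 0 , 0
UX³Y  = 3 , 1 , 0 , 0 , 1 , 0
VX³Y² = 3 , 2 , 0 , 0 , 0 , 1

aSeries bSeries : Series
aSeries = neg (term (+ 1) SX ⊕ term (+ 1) TX²)
bSeries = neg (term (+ 1) UX³Y ⊕ term (+ 1) VX³Y²)

rhsPartial : ℕ → Series
rhsPartial N = (poch aSeries X³Y³ N ⊛ poch bSeries X³Y³ N) ⊛ invPoch X³ X³Y³ N

{-# OPTIONS --safe #-}

-- Put z = x³, q = x³y³, a = sx + tx², b = ux³y + vx³y², and let A z b n and C z b n be the generating
-- functions of the members of 𝒟𝒮³ with largest part at most 3n+2, and of those with largest part 3n+3.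
-- Sorting by the largest parts gives a linear recurrence for (A, C), with coefficients polynomial in
-- qⁿ⁺¹, and this recurrence is intertwined with the one for (qz, qb):
--   (1 + b) A (qz) (qb) n = (1 - z) A z b n + (1 + a) C z b n .
-- Modulo terms of high degree C vanishes for large n, so that A z b = (1 + b) / (1 - z) · A (qz) (qb).
-- Iterating makes z and b disappear, and A 0 0 is the product of the 1 + a qⁱ.
-- All of this takes place in the ring of series modulo total degree D, where z and q are nilpotent,
-- and this turns every limit into a finite identity.
module Submission where

open import Defs
open import Level using (0ℓ)
open import Data.Bool using (Bool; true; false; T)
open import Data.Bool.ListAction using (any)
open import Data.Nat as ℕ using (ℕ; zero; suc; _∸_; _%_; _<_; _>_; _≤_; z≤n; s≤s)
import Data.Nat.Properties as ℕₚ
open import Data.Nat.DivMod using ([m+kn]%n≡m%n)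
open import Data.Nat.ListAction using (sum)
open import Data.Nat.Tactic.RingSolver using (solve-∀)
open import Data.Integer as ℤ using (ℤ; 0ℤ; 1ℤ)
import Data.Integer.Properties as ℤₚ
open import Data.Product using (Σ; ∃; ∃-syntax; _×_; _,_; proj₁; proj₂)
open import Data.Sum using (_⊎_; inj₁; inj₂)
open import Data.Unit using (⊤; tt)
open import Data.List using (List; []; _∷_; _++_; map; length; filter; foldr; concatMap; applyUpTo)
open import Data.List.Properties using (filter-accept; filter-reject; ∷-injectiveʳ)
open import Data.List.Membership.Propositional using (_∈_; _∉_; lose; find)
open import Data.List.Membership.Propositional.Properties
  using (∈-++⁺ˡ; ∈-++⁺ʳ; ∈-++⁻; ∈-map⁺; ∈-map⁻; ∈-filter⁺; ∈-filter⁻; ∈-upTo⁺)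
open import Data.List.Relation.Unary.All as All using (All; []; _∷_)
open import Data.List.Relation.Unary.AllPairs using ([]; _∷_)
open import Data.List.Relation.Unary.Any using (here; there)
open import Data.List.Relation.Unary.Any.Properties using (any⁺; any⁻)
open import Data.List.Relation.Unary.Linked as Linked using (Linked; []; [-]; _∷_)
open import Data.List.Relation.Unary.Linked.Properties using (Linked⇒AllPairs)
open import Data.List.Relation.Unary.Unique.Propositional using (Unique)
import Data.List.Relation.Unary.Unique.Propositional.Properties as Unique
open import Function using (id; _∘_)
open import Function.Bundles using (_⇔_; mk⇔; Equivalence)
open import Relation.Nullary using (¬_; contradiction; yes; no)
open import Relation.Nullary.Decidable using (⌊_⌋; fromWitness; toWitness)
open import Relation.Binary.Bundles using (Setoid)
open import Relation.Binary.Structures using (IsEquivalence)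
open import Relation.Binary.PropositionalEquality as ≡ using (_≡_)
open import Algebra.Bundles using (AbelianGroup; CommutativeRing)
open import Algebra.Consequences.Setoid using (comm∧idˡ⇒id; comm∧distrˡ⇒distr)
import Algebra.Properties.CommutativeSemigroup
import Algebra.Properties.CommutativeSemiring.Exp
import Algebra.Properties.Group
import Algebra.Properties.Ring
import Algebra.Properties.Semiring.Exp
import Algebra.Solver.Ring.NaturalCoefficients.Default
import Relation.Binary.Reasoning.Setoid

-- Sums over the factorizations of a monomial

module Convolutions where
  open import Data.Integer using (_+_; _*_)
  open ≡ using (refl; sym; trans; cong; cong₂; module ≡-Reasoning)
  open Algebra.Properties.CommutativeSemigroup ℤₚ.+-commutativeSemigroup using (interchange)
  open Algebra.Properties.Group (AbelianGroup.group ℤₚ.+-0-abelianGroup) using (identityʳ-unique)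

  -- An abstract finite sum. Interchanging a convolution with such a functional covers pointwise
  -- addition, scaling and the exchange of two convolutions at once.
  record Additive {X : Set} (T : (X → ℤ) → ℤ) : Set where
    field
      T-cong : ∀ {f g} → (∀ x → f x ≡ g x) → T f ≡ T g
      T-add  : ∀ f g → T (λ x → f x + g x) ≡ T f + T g

    T-zero : ∀ {f} → (∀ x → f x ≡ 0ℤ) → T f ≡ 0ℤ
    -- Here `f + f` agrees with `f`, so `T f + T f ≡ T f`, which forces `T f` to vanish.
    T-zero {f} f≡0 = identityʳ-unique (T f) (T f)
      (trans (sym (T-add f f)) (T-cong λ x → trans (cong (_+ f x) (f≡0 x)) (ℤₚ.+-identityˡ (f x))))

  -- Abstract form of m ↦ Σ_{i ∙ j = m} F i j, stated through its action on functions so that it passes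
  -- to products of index monoids.
  record Convolution {I : Set} (_∙_ : I → I → I) : Set₁ where
    field
      ∑       : I → (I → I → ℤ) → ℤ
      ∑-cong  : ∀ m {F G} → (∀ i j → i ∙ j ≡ m → F i j ≡ G i j) → ∑ m F ≡ ∑ m G
      ∑-swap  : ∀ {X} {T : (X → ℤ) → ℤ} → Additive T → ∀ m (F : I → I → X → ℤ) →
                ∑ m (λ i j → T (F i j)) ≡ T (λ x → ∑ m (λ i j → F i j x))
      ∑-comm  : ∀ m F → ∑ m F ≡ ∑ m (λ i j → F j i)
      ∑-assoc : ∀ m (F : I → I → I → ℤ) → ∑ m (λ d k → ∑ d (λ i j → F i j k)) ≡ ∑ m (λ i d → ∑ d (F i))
      ∑-point : ∀ k l F → (∀ i j → i ∙ j ≡ k ∙ l → ¬ (i ≡ k × j ≡ l) → F i j ≡ 0ℤ) →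
                ∑ (k ∙ l) F ≡ F k l

    ∑-add : ∀ m F G → ∑ m (λ i j → F i j + G i j) ≡ ∑ m F + ∑ m G
    -- The two summands are packed into one family indexed by `Bool`, which makes this an instance
    -- of `∑-swap`.
    ∑-add m F G = ∑-swap evaluation m λ i j → λ { true → F i j ; false → G i j }
      where
      evaluation : Additive {Bool} (λ h → h true + h false)
      evaluation = record
        { T-cong = λ eq → cong₂ _+_ (eq true) (eq false)
        ; T-add  = λ f g → interchange (f true) (g true) (f false) (g false) }

    ∑-scaleˡ : ∀ c m F → ∑ m (λ i j → c * F i j) ≡ c * ∑ m F
    ∑-scaleˡ c m F = ∑-swap {T = λ h → c * h tt} scaling m (λ i j _ → F i j)
      where
      scaling : Additive {⊤} (λ h → c * h tt)
      scaling = record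
        { T-cong = λ eq → cong (c *_) (eq tt) ; T-add = λ f g → ℤₚ.*-distribˡ-+ c (f tt) (g tt) }

    ∑-scaleʳ : ∀ c m F → ∑ m (λ i j → F i j * c) ≡ ∑ m F * c
    ∑-scaleʳ c m F = trans (∑-cong m λ i j _ → ℤₚ.*-comm (F i j) c)
                           (trans (∑-scaleˡ c m F) (ℤₚ.*-comm c (∑ m F)))

    ∑-additive : ∀ m → Additive {I × I} (λ h → ∑ m (λ i j → h (i , j)))
    ∑-additive m = record
      { T-cong = λ eq → ∑-cong m λ i j _ → eq (i , j)
      ; T-add  = λ f g → ∑-add m (λ i j → f (i , j)) (λ i j → g (i , j)) }

    ∑-zero : ∀ m F → (∀ i j → i ∙ j ≡ m → F i j ≡ 0ℤ) → ∑ m F ≡ 0ℤ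
    ∑-zero m F F≡0 = trans (∑-cong m F≡0) (Additive.T-zero (∑-additive m) {λ _ → 0ℤ} λ _ → refl)

  open Convolution

  ∑ℕ : ℕ → (ℕ → ℕ → ℤ) → ℤ
  ∑ℕ zero    F = F 0 0
  ∑ℕ (suc n) F = F 0 (suc n) + ∑ℕ n (λ i j → F (suc i) j)

  ∑ℕ-cong : ∀ n {F G} → (∀ i j → i ℕ.+ j ≡ n → F i j ≡ G i j) → ∑ℕ n F ≡ ∑ℕ n G
  ∑ℕ-cong zero    eq = eq 0 0 refl
  ∑ℕ-cong (suc n) eq = cong₂ _+_ (eq 0 (suc n) refl) (∑ℕ-cong n λ i j p → eq (suc i) j (cong suc p))

  ∑ℕ-swap : ∀ {X} {T : (X → ℤ) → ℤ} → Additive T → ∀ n (F : ℕ → ℕ → X → ℤ) →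
            ∑ℕ n (λ i j → T (F i j)) ≡ T (λ x → ∑ℕ n (λ i j → F i j x))
  ∑ℕ-swap add zero    F = refl
  ∑ℕ-swap {T = T} add (suc n) F =
    trans (cong (T (F 0 (suc n)) +_) (∑ℕ-swap add n (λ i → F (suc i))))
          (sym (Additive.T-add add (F 0 (suc n)) _))

  -- `∑ℕ` peels off the term with `i = 0`; symmetry needs the term at the other end as well.
  ∑ℕ-last : ∀ n F → ∑ℕ (suc n) F ≡ ∑ℕ n (λ i j → F i (suc j)) + F (suc n) 0
  ∑ℕ-last zero    F = refl
  ∑ℕ-last (suc n) F =
    trans (cong (F 0 (suc (suc n)) +_) (∑ℕ-last n (λ i → F (suc i))))
          (sym (ℤₚ.+-assoc (F 0 (suc (suc n))) _ _))

  ∑ℕ-comm : ∀ n F → ∑ℕ n F ≡ ∑ℕ n (λ i j → F j i)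
  ∑ℕ-comm zero    F = refl
  ∑ℕ-comm (suc n) F = trans (∑ℕ-last n F) (trans (ℤₚ.+-comm _ (F (suc n) 0))
    (cong (F (suc n) 0 +_) (∑ℕ-comm n (λ i j → F i (suc j)))))

  ∑ℕ-add : ∀ n F G → ∑ℕ n (λ i j → F i j + G i j) ≡ ∑ℕ n F + ∑ℕ n G
  ∑ℕ-add zero    F G = refl
  ∑ℕ-add (suc n) F G = trans (cong (F 0 (suc n) + G 0 (suc n) +_) (∑ℕ-add n _ _))
    (interchange (F 0 (suc n)) (G 0 (suc n)) _ _)

  ∑ℕ-assoc : ∀ n F → ∑ℕ n (λ d k → ∑ℕ d (λ i j → F i j k)) ≡ ∑ℕ n (λ i d → ∑ℕ d (F i))
  ∑ℕ-assoc zero    F = refl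
  ∑ℕ-assoc (suc n) F = begin
    F 0 0 (suc n) + ∑ℕ n (λ d k → F 0 (suc d) k + ∑ℕ d (λ i j → F (suc i) j k))
      ≡⟨ cong (F 0 0 (suc n) +_) (∑ℕ-add n _ _) ⟩
    F 0 0 (suc n) + (∑ℕ n (λ d k → F 0 (suc d) k) + ∑ℕ n (λ d k → ∑ℕ d (λ i j → F (suc i) j k)))
      -- All terms with `i = 0` are now together, and with the separate term in front they form
      -- `∑ℕ (suc n) (F 0)`.
      ≡⟨ ℤₚ.+-assoc (F 0 0 (suc n)) _ _ ⟨
    ∑ℕ (suc n) (F 0) + ∑ℕ n (λ d k → ∑ℕ d (λ i j → F (suc i) j k))
      ≡⟨ cong (∑ℕ (suc n) (F 0) +_) (∑ℕ-assoc n (λ i → F (suc i))) ⟩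
    ∑ℕ (suc n) (F 0) + ∑ℕ n (λ i d → ∑ℕ d (F (suc i))) ∎
    where open ≡-Reasoning

  ∑ℕ-zero : ∀ n F → (∀ i j → i ℕ.+ j ≡ n → F i j ≡ 0ℤ) → ∑ℕ n F ≡ 0ℤ
  ∑ℕ-zero zero    F F≡0 = F≡0 0 0 refl
  ∑ℕ-zero (suc n) F F≡0 =
    cong₂ _+_ (F≡0 0 (suc n) refl) (∑ℕ-zero n _ λ i j p → F≡0 (suc i) j (cong suc p))

  ∑ℕ-point : ∀ k l F → (∀ i j → i ℕ.+ j ≡ k ℕ.+ l → ¬ (i ≡ k × j ≡ l) → F i j ≡ 0ℤ) →
             ∑ℕ (k ℕ.+ l) F ≡ F k l
  ∑ℕ-point zero zero    F _   = refl
  ∑ℕ-point zero (suc l) F F≡0 =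
    trans (cong (F 0 (suc l) +_) (∑ℕ-zero l _ λ i j p → F≡0 (suc i) j (cong suc p) λ ()))
          (ℤₚ.+-identityʳ (F 0 (suc l)))
  ∑ℕ-point (suc k) l    F F≡0 =
    trans (cong₂ _+_ (F≡0 0 _ refl λ ())
                 (∑ℕ-point k l (λ i → F (suc i)) λ i j p ne →
                   F≡0 (suc i) j (cong suc p) λ { (refl , q) → ne (refl , q) }))
          (ℤₚ.+-identityˡ (F (suc k) l))

  convℕ : Convolution ℕ._+_
  convℕ = record
    { ∑ = ∑ℕ ; ∑-cong = ∑ℕ-cong ; ∑-swap = ∑ℕ-swap ; ∑-comm = ∑ℕ-comm ; ∑-assoc = ∑ℕ-assoc
    ; ∑-point = ∑ℕ-point }

  infixr 2 _⊗_

  _⊗_ : ∀ {I J} {_∙_ : I → I → I} {_∘_ : J → J → J} → Convolution _∙_ → Convolution _∘_ →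
        Convolution (λ (x y : I × J) → (proj₁ x ∙ proj₁ y , proj₂ x ∘ proj₂ y))
  A ⊗ B = record
    { ∑       = λ (a , b) F → ∑ A a λ i j → ∑ B b λ i′ j′ → F (i , i′) (j , j′)
    ; ∑-cong  = λ (a , b) eq → ∑-cong A a λ i j p → ∑-cong B b λ i′ j′ p′ →
                  eq (i , i′) (j , j′) (cong₂ _,_ p p′)
    ; ∑-swap  = λ add (a , b) F → trans
                  (∑-cong A a λ i j _ → ∑-swap B add b λ i′ j′ → F (i , i′) (j , j′))
                  (∑-swap A add a λ i j x → ∑ B b λ i′ j′ → F (i , i′) (j , j′) x)
    ; ∑-comm  = λ (a , b) F → trans
                  (∑-cong A a λ i j _ → ∑-comm B b λ i′ j′ → F (i , i′) (j , j′))
                  (∑-comm A a λ i j → ∑ B b λ i′ j′ → F (i , j′) (j , i′))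
    -- Associativity holds in each coordinate. The outer sum of the second coordinate is moved
    -- inside the inner sum of the first by `∑-swap`, and moved back at the end.
    ; ∑-assoc = λ (a , b) F → begin
        ∑ A a (λ d k → ∑ B b λ d′ k′ → ∑ A d λ i j → ∑ B d′ λ i′ j′ → F (i , i′) (j , j′) (k , k′))
          ≡⟨ ∑-cong A a (λ d k _ → ∑-swap B (∑-additive A d) b
               λ { d′ k′ (i , j) → ∑ B d′ λ i′ j′ → F (i , i′) (j , j′) (k , k′) }) ⟩
        ∑ A a (λ d k → ∑ A d λ i j → ∑ B b λ d′ k′ → ∑ B d′ λ i′ j′ → F (i , i′) (j , j′) (k , k′))
          ≡⟨ ∑-cong A a (λ d k _ → ∑-cong A d λ i j _ → ∑-assoc B b
               λ i′ j′ k′ → F (i , i′) (j , j′) (k , k′)) ⟩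
        ∑ A a (λ d k → ∑ A d λ i j → ∑ B b λ i′ d′ → ∑ B d′ λ j′ k′ → F (i , i′) (j , j′) (k , k′))
          ≡⟨ ∑-assoc A a (λ i j k → ∑ B b λ i′ d′ → ∑ B d′ λ j′ k′ → F (i , i′) (j , j′) (k , k′)) ⟩
        ∑ A a (λ i d → ∑ A d λ j k → ∑ B b λ i′ d′ → ∑ B d′ λ j′ k′ → F (i , i′) (j , j′) (k , k′))
          ≡⟨ ∑-cong A a (λ i d _ → ∑-swap B (∑-additive A d) b
               λ { i′ d′ (j , k) → ∑ B d′ λ j′ k′ → F (i , i′) (j , j′) (k , k′) }) ⟨
        ∑ A a (λ i d → ∑ B b λ i′ d′ → ∑ A d λ j k → ∑ B d′ λ j′ k′ → F (i , i′) (j , j′) (k , k′)) ∎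
    ; ∑-point = λ (k , k′) (l , l′) F F≡0 → trans
        (∑-point A k l _ λ i j p ne → ∑-zero B _ _ λ i′ j′ p′ →
          F≡0 _ _ (cong₂ _,_ p p′) λ { (refl , refl) → ne (refl , refl) })
        (∑-point B k′ l′ _ λ i′ j′ p′ ne → F≡0 _ _ (cong₂ _,_ refl p′) λ { (refl , refl) → ne (refl , refl) })
    }
    where open ≡-Reasoning

  convMono : Convolution _·M_
  convMono = convℕ ⊗ convℕ ⊗ convℕ ⊗ convℕ ⊗ convℕ ⊗ convℕ

  sumOver : {X : Set} → (X → ℤ) → List X → ℤ
  sumOver h xs = foldr _+_ 0ℤ (map h xs)

  sumOver-cong : {X : Set} {g h : X → ℤ} → (∀ x → g x ≡ h x) → ∀ xs → sumOver g xs ≡ sumOver h xs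
  sumOver-cong eq []       = refl
  sumOver-cong eq (x ∷ xs) = cong₂ _+_ (eq x) (sumOver-cong eq xs)

  sumOver-++ : {X : Set} (h : X → ℤ) → ∀ xs ys → sumOver h (xs ++ ys) ≡ sumOver h xs + sumOver h ys
  sumOver-++ h []       ys = sym (ℤₚ.+-identityˡ _)
  sumOver-++ h (x ∷ xs) ys = trans (cong (h x +_) (sumOver-++ h xs ys)) (sym (ℤₚ.+-assoc (h x) _ _))

  sumOver-map : {X Y : Set} (h : Y → ℤ) (k : X → Y) → ∀ xs → sumOver h (map k xs) ≡ sumOver (h ∘ k) xs
  sumOver-map h k []       = refl
  sumOver-map h k (x ∷ xs) = cong (h (k x) +_) (sumOver-map h k xs)

  sumOver-concatMap : {X Y : Set} (h : Y → ℤ) (k : X → List Y) →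
                      ∀ xs → sumOver h (concatMap k xs) ≡ sumOver (λ x → sumOver h (k x)) xs
  sumOver-concatMap h k []       = refl
  sumOver-concatMap h k (x ∷ xs) =
    trans (sumOver-++ h (k x) _) (cong (sumOver h (k x) +_) (sumOver-concatMap h k xs))

  sumOver-applyUpTo : (h : ℕ → ℤ) (f : ℕ → ℕ) → ∀ n →
                      sumOver h (applyUpTo f (suc n)) ≡ ∑ℕ n (λ i _ → h (f i))
  sumOver-applyUpTo h f zero    = ℤₚ.+-identityʳ (h (f 0))
  sumOver-applyUpTo h f (suc n) = cong (h (f 0) +_) (sumOver-applyUpTo h (f ∘ suc) n)

  sumOver-range : ∀ n (F : ℕ → ℕ → ℤ) → sumOver (λ i → F i (n ∸ i)) (range n) ≡ ∑ℕ n F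
  sumOver-range n F = trans (sumOver-applyUpTo (λ i → F i (n ∸ i)) id n)
    (∑ℕ-cong n λ { i j refl → cong (F i) (ℕₚ.m+n∸m≡n i j) })

  -- Connects the product `⊛` with the abstract convolution: `divisors` runs through the six
  -- coordinates in nested lists, each level is one `∑ℕ`, and subtraction gives the complementary
  -- exponent.
  sumOver-divisors : ∀ m (F : Mono → Mono → ℤ) → sumOver (λ d → F d (m ∸M d)) (divisors m) ≡ ∑ convMono m F
  sumOver-divisors (a , b , c , d , e , f) F =
    level a ks _ λ a₁ → level b (ks₁ a₁) _ λ b₁ → level c (ks₂ a₁ b₁) _ λ c₁ →
    level d (ks₃ a₁ b₁ c₁) _ λ d₁ → level e (ks₄ a₁ b₁ c₁ d₁) _ λ e₁ →
    trans (sumOver-map h _ (range f))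
          (sumOver-range f λ f₁ f₂ →
            F (a₁ , b₁ , c₁ , d₁ , e₁ , f₁) (a ∸ a₁ , b ∸ b₁ , c ∸ c₁ , d ∸ d₁ , e ∸ e₁ , f₂))
    where
    h : Mono → ℤ
    h x = F x ((a , b , c , d , e , f) ∸M x)

    ks₄ : (a₁ b₁ c₁ d₁ e₁ : ℕ) → List Mono
    ks₄ a₁ b₁ c₁ d₁ e₁ = map (λ f₁ → a₁ , b₁ , c₁ , d₁ , e₁ , f₁) (range f)
    ks₃ : (a₁ b₁ c₁ d₁ : ℕ) → List Mono
    ks₃ a₁ b₁ c₁ d₁ = concatMap (ks₄ a₁ b₁ c₁ d₁) (range e)
    ks₂ : (a₁ b₁ c₁ : ℕ) → List Mono
    ks₂ a₁ b₁ c₁ = concatMap (ks₃ a₁ b₁ c₁) (range d)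
    ks₁ : (a₁ b₁ : ℕ) → List Mono
    ks₁ a₁ b₁ = concatMap (ks₂ a₁ b₁) (range c)
    ks : ℕ → List Mono
    ks a₁ = concatMap (ks₁ a₁) (range b)

    level : ∀ n (k : ℕ → List Mono) (G : ℕ → ℕ → ℤ) →
            (∀ i → sumOver h (k i) ≡ G i (n ∸ i)) → sumOver h (concatMap k (range n)) ≡ ∑ℕ n G
    level n k G eq = trans (sumOver-concatMap h k (range n))
      (trans (sumOver-cong eq (range n)) (sumOver-range n G))

open Convolutions using (module Convolution; convMono; sumOver-divisors)

-- The ring of series modulo total degree `D`, and geometric series

module TruncatedSeries where
  open import Data.Integer using (_+_; _*_)
  open ≡ using (refl; sym; trans; cong; cong₂; subst; module ≡-Reasoning)
  open Convolution convMono

  Mono-≡ : ∀ {a b c d e f a' b' c' d' e' f'} →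
    a ≡ a' → b ≡ b' → c ≡ c' → d ≡ d' → e ≡ e' → f ≡ f' →
    _≡_ {A = Mono} (a , b , c , d , e , f) (a' , b' , c' , d' , e' , f')
  Mono-≡ refl refl refl refl refl refl = refl

  ·M-∸M : ∀ k l → (k ·M l) ∸M k ≡ l
  ·M-∸M (a , b , c , d , e , f) (a' , b' , c' , d' , e' , f') = Mono-≡
    (ℕₚ.m+n∸m≡n a a') (ℕₚ.m+n∸m≡n b b') (ℕₚ.m+n∸m≡n c c')
    (ℕₚ.m+n∸m≡n d d') (ℕₚ.m+n∸m≡n e e') (ℕₚ.m+n∸m≡n f f')

  ·M-cancelˡ : ∀ k l l' → k ·M l ≡ k ·M l' → l ≡ l'
  ·M-cancelˡ k l l' eq = trans (sym (·M-∸M k l)) (trans (cong (_∸M k) eq) (·M-∸M k l'))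

  totalDeg-· : ∀ k l → totalDeg (k ·M l) ≡ totalDeg k ℕ.+ totalDeg l
  totalDeg-· (a , b , c , d , e , f) (a' , b' , c' , d' , e' , f') = lemma a b c d e f a' b' c' d' e' f'
    where
    lemma : ∀ a b c d e f a' b' c' d' e' f' →
      (a ℕ.+ a') ℕ.+ (b ℕ.+ b') ℕ.+ (c ℕ.+ c') ℕ.+ (d ℕ.+ d') ℕ.+ (e ℕ.+ e') ℕ.+ (f ℕ.+ f') ≡
      (a ℕ.+ b ℕ.+ c ℕ.+ d ℕ.+ e ℕ.+ f) ℕ.+ (a' ℕ.+ b' ℕ.+ c' ℕ.+ d' ℕ.+ e' ℕ.+ f')
    lemma = solve-∀

  totalDeg-^ : ∀ m k → totalDeg (m ^M k) ≡ k ℕ.* totalDeg m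
  totalDeg-^ m zero    = refl
  totalDeg-^ m (suc k) = trans (totalDeg-· m (m ^M k)) (cong (totalDeg m ℕ.+_) (totalDeg-^ m k))

  term-at : ∀ c m → term c m m ≡ c
  term-at c m with m ≟M m
  ... | yes _   = refl
  ... | no  m≢m = contradiction refl m≢m

  term-off : ∀ c m n → ¬ m ≡ n → term c m n ≡ 0ℤ
  term-off c m n m≢n with m ≟M n
  ... | yes m≡n = contradiction m≡n m≢n
  ... | no  _   = refl

  ⊛-∑ : ∀ f g m → (f ⊛ g) m ≡ ∑ m (λ i j → f i * g j)
  ⊛-∑ f g m = sumOver-divisors m λ i j → f i * g j

  -- By cancellation, `(k , l)` is the only factorization of `k ·M l` with first factor `k`, so
  -- multiplying by a monomial merely shifts coefficients.
  ⊛-term-at : ∀ k g l → (term 1ℤ k ⊛ g) (k ·M l) ≡ g l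
  ⊛-term-at k g l = begin
    (term 1ℤ k ⊛ g) (k ·M l)
      ≡⟨ ⊛-∑ (term 1ℤ k) g (k ·M l) ⟩
    ∑ (k ·M l) (λ i j → term 1ℤ k i * g j)
      ≡⟨ ∑-point k l _ (λ i j p ne → cong (_* g j)
           (term-off 1ℤ k i λ { refl → ne (refl , ·M-cancelˡ k j l p) })) ⟩
    term 1ℤ k k * g l
      ≡⟨ trans (cong (_* g l) (term-at 1ℤ k)) (ℤₚ.*-identityˡ (g l)) ⟩
    g l ∎
    where open ≡-Reasoning

  ⊛-term-off : ∀ k g n → (∀ l → ¬ n ≡ k ·M l) → (term 1ℤ k ⊛ g) n ≡ 0ℤ
  ⊛-term-off k g n ne = trans (⊛-∑ (term 1ℤ k) g n)
    (∑-zero n _ λ i j p → cong (_* g j) (term-off 1ℤ k i λ { refl → ne j (sym p) }))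

  module Truncated (D : ℕ) where

    infix 4 _≈_

    -- Congruence modulo the monomials of total degree at least `D`, wrapped in a record so that the
    -- two series can be inferred from a proof.
    record _≈_ (f g : Series) : Set where
      constructor eq
      field at : ∀ m → totalDeg m ℕ.< D → f m ≡ g m
    open _≈_ public

    pointwise : ∀ {f g} → (∀ m → f m ≡ g m) → f ≈ g
    pointwise f≡g = eq λ m _ → f≡g m

    -- Degrees add under multiplication, so both factors of a monomial of degree below `D` are
    -- themselves of degree below `D`.
    ⊛-cong : ∀ {f f' g g'} → f ≈ f' → g ≈ g' → f ⊛ g ≈ f' ⊛ g'
    ⊛-cong {f} {f'} {g} {g'} f≈f' g≈g' = eq λ m m<D → trans (⊛-∑ f g m) (trans
      (∑-cong m λ { i j refl → let m<D' = subst (ℕ._< D) (totalDeg-· i j) m<D in cong₂ _*_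
        (at f≈f' i (ℕₚ.≤-<-trans (ℕₚ.m≤m+n (totalDeg i) (totalDeg j)) m<D'))
        (at g≈g' j (ℕₚ.≤-<-trans (ℕₚ.m≤n+m (totalDeg j) (totalDeg i)) m<D')) })
      (sym (⊛-∑ f' g' m)))

    ⊛-comm : ∀ f g → f ⊛ g ≈ g ⊛ f
    ⊛-comm f g = pointwise λ m → trans (⊛-∑ f g m) (trans (∑-comm m (λ i j → f i * g j))
      (trans (∑-cong m λ i j _ → ℤₚ.*-comm (f j) (g i)) (sym (⊛-∑ g f m))))

    ⊛-assoc : ∀ f g h → (f ⊛ g) ⊛ h ≈ f ⊛ (g ⊛ h)
    ⊛-assoc f g h = pointwise λ m → begin
      ((f ⊛ g) ⊛ h) m
        ≡⟨ ⊛-∑ (f ⊛ g) h m ⟩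
      ∑ m (λ d k → (f ⊛ g) d * h k)
        ≡⟨ ∑-cong m (λ d k _ → trans (cong (_* h k) (⊛-∑ f g d)) (sym (∑-scaleʳ (h k) d _))) ⟩
      ∑ m (λ d k → ∑ d (λ i j → f i * g j * h k))
        ≡⟨ ∑-assoc m (λ i j k → f i * g j * h k) ⟩
      ∑ m (λ i d → ∑ d (λ j k → f i * g j * h k))
        ≡⟨ ∑-cong m (λ i d _ → trans (∑-cong d λ j k _ → ℤₚ.*-assoc (f i) (g j) (h k))
             (trans (∑-scaleˡ (f i) d _) (cong (f i *_) (sym (⊛-∑ g h d))))) ⟩
      ∑ m (λ i d → f i * (g ⊛ h) d)
        ≡⟨ ⊛-∑ f (g ⊛ h) m ⟨
      (f ⊛ (g ⊛ h)) m ∎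
      where open ≡-Reasoning

    ⊛-identityˡ : ∀ f → one ⊛ f ≈ f
    ⊛-identityˡ f = pointwise (⊛-term-at oneM f)

    ⊛-distribˡ : ∀ f g h → f ⊛ (g ⊕ h) ≈ (f ⊛ g) ⊕ (f ⊛ h)
    ⊛-distribˡ f g h = pointwise λ m → trans (⊛-∑ f (g ⊕ h) m) (trans
      (∑-cong m λ i j _ → ℤₚ.*-distribˡ-+ (f i) (g j) (h j))
      (trans (∑-add m (λ i j → f i * g j) (λ i j → f i * h j))
             (sym (cong₂ _+_ (⊛-∑ f g m) (⊛-∑ f h m)))))

    ring : CommutativeRing 0ℓ 0ℓ
    ring = record
      { Carrier = Series ; _≈_ = _≈_ ; _+_ = _⊕_ ; _*_ = _⊛_ ; -_ = neg ; 0# = λ _ → 0ℤ ; 1# = one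
      ; isCommutativeRing = record
        { isRing = record
          { +-isAbelianGroup = record
            { isGroup = record
              { isMonoid = record
                { isSemigroup = record
                  { isMagma = record
                    { isEquivalence = ≈-equiv
                    ; ∙-cong = λ p q → eq λ m m<D → cong₂ _+_ (at p m m<D) (at q m m<D) }
                  ; assoc = λ f g h → pointwise λ m → ℤₚ.+-assoc (f m) (g m) (h m) }
                ; identity = (λ f → pointwise λ m → ℤₚ.+-identityˡ (f m))
                           , (λ f → pointwise λ m → ℤₚ.+-identityʳ (f m)) }
              ; inverse = (λ f → pointwise λ m → ℤₚ.+-inverseˡ (f m))
                        , (λ f → pointwise λ m → ℤₚ.+-inverseʳ (f m))
              ; ⁻¹-cong = λ p → eq λ m m<D → cong ℤ.-_ (at p m m<D) }
            ; comm = λ f g → pointwise λ m → ℤₚ.+-comm (f m) (g m) }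
          ; *-cong = ⊛-cong
          ; *-assoc = ⊛-assoc
          ; *-identity = comm∧idˡ⇒id ≈-setoid ⊛-comm ⊛-identityˡ
          ; distrib = comm∧distrˡ⇒distr ≈-setoid
              (λ p q → eq λ m m<D → cong₂ _+_ (at p m m<D) (at q m m<D)) ⊛-comm ⊛-distribˡ }
        ; *-comm = ⊛-comm } }
      where
      ≈-equiv : IsEquivalence _≈_
      ≈-equiv = record
        { refl = pointwise λ _ → refl ; sym = λ p → eq λ m m<D → sym (at p m m<D)
        ; trans = λ p q → eq λ m m<D → trans (at p m m<D) (at q m m<D) }
      ≈-setoid : Setoid 0ℓ 0ℓ
      ≈-setoid = record { isEquivalence = ≈-equiv }

    term-⊛ : ∀ k l → term 1ℤ k ⊛ term 1ℤ l ≈ term 1ℤ (k ·M l)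
    term-⊛ k l = pointwise go
      where
      go : ∀ n → (term 1ℤ k ⊛ term 1ℤ l) n ≡ term 1ℤ (k ·M l) n
      -- This test decides divisibility of `n` by `k`: truncated subtraction yields a cofactor
      -- exactly when there is one.
      go n with (k ·M (n ∸M k)) ≟M n
      ... | no ne = trans (⊛-term-off k (term 1ℤ l) n λ { l' refl → ne (cong (k ·M_) (·M-∸M k l')) })
                          (sym (term-off 1ℤ (k ·M l) n λ { refl → ne (cong (k ·M_) (·M-∸M k l)) }))
      ... | yes p with l ≟M (n ∸M k)
      ...   | yes refl = trans (cong (term 1ℤ k ⊛ term 1ℤ l) (sym p)) (trans (⊛-term-at k (term 1ℤ l) l)
                           (trans (term-at 1ℤ l) (trans (sym (term-at 1ℤ (k ·M l))) (cong (term 1ℤ (k ·M l)) p))))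
      ...   | no ne = trans (cong (term 1ℤ k ⊛ term 1ℤ l) (sym p)) (trans (⊛-term-at k (term 1ℤ l) (n ∸M k))
                        (trans (term-off 1ℤ l _ ne)
                          (sym (term-off 1ℤ (k ·M l) n λ q → ne (·M-cancelˡ k l _ (trans q (sym p)))))))

    term-small : ∀ k → D ℕ.≤ totalDeg k → term 1ℤ k ≈ (λ _ → 0ℤ)
    term-small k D≤k = eq λ m m<D → term-off 1ℤ k m λ { refl → ℕₚ.<⇒≱ m<D D≤k }

  -- `geom` searches exponents only up to `totalDeg n`. No power is missed, because for `m` of
  -- positive degree `m ^M k` has degree at least `k`.
  geom-cases : ∀ m n → 0 ℕ.< totalDeg m →
    (∃ λ k → m ^M k ≡ n × geom m n ≡ 1ℤ) ⊎ ((∀ k → ¬ m ^M k ≡ n) × geom m n ≡ 0ℤ)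
  geom-cases m n 0<m with any (λ k → ⌊ (m ^M k) ≟M n ⌋) (range (totalDeg n)) in e
  ... | true with find (any⁻ (λ k → ⌊ (m ^M k) ≟M n ⌋) (range (totalDeg n)) (subst T (sym e) tt))
  ...   | k , _ , t = inj₁ (k , toWitness t , refl)
  geom-cases m n 0<m | false = inj₂ (nonpower , refl)
    where
    nonpower : ∀ k → ¬ m ^M k ≡ n
    nonpower k refl = subst T e (any⁺ _ (lose (∈-upTo⁺ (s≤s k≤deg)) (fromWitness refl)))
      where
      k≤deg : k ℕ.≤ totalDeg (m ^M k)
      k≤deg = subst (k ℕ.≤_) (sym (totalDeg-^ m k)) (ℕₚ.m≤m*n k (totalDeg m) {{ℕ.>-nonZero 0<m}})

  -- This relation makes `geom m` an inverse of `1 - m`. The constant term is clear since `m ·M l`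
  -- has positive degree; elsewhere, `m ·M l` is a power of `m` exactly when `l` is.
  geom-unfold : ∀ m → 0 ℕ.< totalDeg m → ∀ n → geom m n ≡ (one ⊕ (term 1ℤ m ⊛ geom m)) n
  geom-unfold m 0<m n with n ≟M oneM
  geom-unfold m 0<m n | yes refl with geom-cases m oneM 0<m
  ... | inj₁ (_ , _ , p) = trans p (cong (1ℤ +_) (sym (⊛-term-off m (geom m) oneM λ l q →
          ℕₚ.<⇒≢ (ℕₚ.<-≤-trans 0<m (ℕₚ.m≤m+n (totalDeg m) (totalDeg l)))
                 (trans (cong totalDeg q) (totalDeg-· m l)))))
  ... | inj₂ (ne , _)    = contradiction refl (ne 0)
  geom-unfold m 0<m n | no n≢1 = trans (tail n n≢1) (sym (trans
      (cong (_+ (term 1ℤ m ⊛ geom m) n) (term-off 1ℤ oneM n (n≢1 ∘ sym))) (ℤₚ.+-identityˡ _)))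
    where
    tail : ∀ n → ¬ n ≡ oneM → geom m n ≡ (term 1ℤ m ⊛ geom m) n
    tail n n≢1 with (m ·M (n ∸M m)) ≟M n
    tail n n≢1 | no ne with geom-cases m n 0<m
    ... | inj₁ (zero , p , _)  = contradiction (sym p) n≢1
    ... | inj₁ (suc k , refl , _) = contradiction (cong (m ·M_) (·M-∸M m (m ^M k))) ne
    ... | inj₂ (_ , p) = trans p (sym (⊛-term-off m (geom m) n λ { l refl → ne (cong (m ·M_) (·M-∸M m l)) }))
    tail n n≢1 | yes p = subst (λ x → geom m x ≡ (term 1ℤ m ⊛ geom m) x) p
      (trans (step (n ∸M m) (n≢1 ∘ trans (sym p))) (sym (⊛-term-at m (geom m) (n ∸M m))))
      where
      step : ∀ l → ¬ (m ·M l) ≡ oneM → geom m (m ·M l) ≡ geom m l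
      step l ml≢1 with geom-cases m (m ·M l) 0<m | geom-cases m l 0<m
      ... | inj₁ (_ , _ , p)     | inj₁ (_ , _ , q) = trans p (sym q)
      ... | inj₂ (_ , p)         | inj₂ (_ , q)     = trans p (sym q)
      ... | inj₂ (ne , _)        | inj₁ (k , q , _) = contradiction (cong (m ·M_) q) (ne (suc k))
      ... | inj₁ (zero , p , _)  | inj₂ _           = contradiction (sym p) ml≢1
      ... | inj₁ (suc k , p , _) | inj₂ (ne , _)    = contradiction (·M-cancelˡ m (m ^M k) l p) (ne k)

open TruncatedSeries

-- The coupled recurrence and its solution as a product

module Recurrence {c ℓ} (R : CommutativeRing c ℓ) (a q : CommutativeRing.Carrier R) where
  open CommutativeRing R
  open Algebra.Solver.Ring.NaturalCoefficients.Default commutativeSemiring using (solve; _:=_; _:+_; _:*_; con)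
  open Algebra.Properties.Semiring.Exp semiring using (_^_; ^-homo-*)
  open Algebra.Properties.CommutativeSemiring.Exp commutativeSemiring using (^-distrib-*)
  open Algebra.Properties.Group +-group using () renaming (∙-cancelʳ to +-cancelʳ)
  open Relation.Binary.Reasoning.Setoid setoid

  Π : ℕ → (ℕ → Carrier) → Carrier
  Π zero    F = 1#
  Π (suc n) F = Π n F * F n

  -- In the intended reading, the initial values come from the partitions ∅, (1), (2) and from (3),
  -- (3,1), (3,2). The step lets in the parts 3n+3, 3n+4, 3n+5 for `A`, and for `C` also puts 3n+6
  -- on top.
  A C : (z b : Carrier) → ℕ → Carrier
  A z b zero    = 1# + a
  A z b (suc n) = (1# + a * q ^ suc n) * A z b n + (1# + a) * C z b n
  C z b zero    = z + b
  C z b (suc n) = (z + b * q ^ suc n) * C z b n + q ^ suc n * (z + b) * A z b n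

  A-cong : ∀ {z b z′ b′} → z ≈ z′ → b ≈ b′ → ∀ n → A z b n ≈ A z′ b′ n
  C-cong : ∀ {z b z′ b′} → z ≈ z′ → b ≈ b′ → ∀ n → C z b n ≈ C z′ b′ n
  A-cong z≈ b≈ zero    = refl
  A-cong z≈ b≈ (suc n) = +-cong (*-congˡ (A-cong z≈ b≈ n)) (*-congˡ (C-cong z≈ b≈ n))
  C-cong z≈ b≈ zero    = +-cong z≈ b≈
  C-cong z≈ b≈ (suc n) = +-cong (*-cong (+-cong z≈ (*-congʳ b≈)) (C-cong z≈ b≈ n))
                                (*-cong (*-congˡ (+-cong z≈ b≈)) (A-cong z≈ b≈ n))

  module _ {z b z′ b′ : Carrier} (z′≈ : z′ ≈ z * q) (b′≈ : b′ ≈ b * q) where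

    -- All terms are moved to the side where they are positive, so that the induction steps are semiring
    -- identities up to cancelling a common summand.
    shift-A : ∀ n → (1# + b) * A z′ b′ n + z * A z b n ≈ A z b n + (1# + a) * C z b n
    shift-C : ∀ n → (1# + b) * C z′ b′ n + q ^ suc n * a * C z b n
                  ≈ q ^ suc n * ((z + b) * A z b n + b * C z b n)

    shift-A zero = solve 3 (λ a z b →
      (con 1 :+ b) :* (con 1 :+ a) :+ z :* (con 1 :+ a) :=
      (con 1 :+ a) :+ (con 1 :+ a) :* (z :+ b)) refl a z b
    -- The recurrence mixes `A` and `C`, so both identities advance together. Up to the factor
    -- `1# + a`, the added summand completes `(1# + b) * Y` to the left side of `shift-C n`.
    shift-A (suc n) = +-cancelʳ ((1# + a) * (p * a * Cₙ)) _ _ (begin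
      (1# + b) * ((1# + a * p) * X + (1# + a) * Y) + z * ((1# + a * p) * Aₙ + (1# + a) * Cₙ)
        + (1# + a) * (p * a * Cₙ)
        ≈⟨ solve 8 (λ a z b p X Y Aₙ Cₙ →
             (con 1 :+ b) :* ((con 1 :+ a :* p) :* X :+ (con 1 :+ a) :* Y)
               :+ z :* ((con 1 :+ a :* p) :* Aₙ :+ (con 1 :+ a) :* Cₙ)
               :+ (con 1 :+ a) :* (p :* a :* Cₙ) :=
             (con 1 :+ a :* p) :* ((con 1 :+ b) :* X :+ z :* Aₙ)
               :+ (con 1 :+ a) :* ((con 1 :+ b) :* Y :+ p :* a :* Cₙ) :+ (con 1 :+ a) :* z :* Cₙ)
             refl a z b p X Y Aₙ Cₙ ⟩
      (1# + a * p) * ((1# + b) * X + z * Aₙ) + (1# + a) * ((1# + b) * Y + p * a * Cₙ) + (1# + a) * z * Cₙ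
        ≈⟨ +-congʳ (+-cong (*-congˡ (shift-A n)) (*-congˡ (shift-C n))) ⟩
      (1# + a * p) * (Aₙ + (1# + a) * Cₙ) + (1# + a) * (p * ((z + b) * Aₙ + b * Cₙ)) + (1# + a) * z * Cₙ
        ≈⟨ solve 6 (λ a z b p Aₙ Cₙ →
             (con 1 :+ a :* p) :* (Aₙ :+ (con 1 :+ a) :* Cₙ)
               :+ (con 1 :+ a) :* (p :* ((z :+ b) :* Aₙ :+ b :* Cₙ)) :+ (con 1 :+ a) :* z :* Cₙ :=
             ((con 1 :+ a :* p) :* Aₙ :+ (con 1 :+ a) :* Cₙ)
               :+ (con 1 :+ a) :* ((z :+ b :* p) :* Cₙ :+ p :* (z :+ b) :* Aₙ)
               :+ (con 1 :+ a) :* (p :* a :* Cₙ))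
             refl a z b p Aₙ Cₙ ⟩
      ((1# + a * p) * Aₙ + (1# + a) * Cₙ) + (1# + a) * ((z + b * p) * Cₙ + p * (z + b) * Aₙ)
        + (1# + a) * (p * a * Cₙ) ∎)
      where
      p  = q ^ suc n
      X  = A z′ b′ n
      Y  = C z′ b′ n
      Aₙ = A z b n
      Cₙ = C z b n

    shift-C zero = begin
      (1# + b) * (z′ + b′) + q * 1# * a * (z + b)
        ≈⟨ +-congʳ (*-congˡ (+-cong z′≈ b′≈)) ⟩
      (1# + b) * (z * q + b * q) + q * 1# * a * (z + b)
        ≈⟨ solve 4 (λ a z b q →
             (con 1 :+ b) :* (z :* q :+ b :* q) :+ q :* con 1 :* a :* (z :+ b) :=
             q :* con 1 :* ((z :+ b) :* (con 1 :+ a) :+ b :* (z :+ b))) refl a z b q ⟩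
      q * 1# * ((z + b) * (1# + a) + b * (z + b)) ∎
    -- The two added summands complete the terms in `Y` and `X` to multiples of the left sides of
    -- `shift-C n` and `shift-A n`.
    shift-C (suc n) = +-cancelʳ (q * (z + b * p) * (p * a * Cₙ) + q * p * (z + b) * (z * Aₙ)) _ _ (begin
      (1# + b) * ((z′ + b′ * p) * Y + p * (z′ + b′) * X)
        + q * p * a * ((z + b * p) * Cₙ + p * (z + b) * Aₙ)
        + (q * (z + b * p) * (p * a * Cₙ) + q * p * (z + b) * (z * Aₙ))
        ≈⟨ +-congʳ (+-congʳ (*-congˡ (+-cong (*-congʳ (+-cong z′≈ (*-congʳ b′≈)))
             (*-congʳ (*-congˡ (+-cong z′≈ b′≈)))))) ⟩
      (1# + b) * ((z * q + b * q * p) * Y + p * (z * q + b * q) * X)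
        + q * p * a * ((z + b * p) * Cₙ + p * (z + b) * Aₙ)
        + (q * (z + b * p) * (p * a * Cₙ) + q * p * (z + b) * (z * Aₙ))
        ≈⟨ solve 9 (λ a q z b p X Y Aₙ Cₙ →
             (con 1 :+ b) :* ((z :* q :+ b :* q :* p) :* Y :+ p :* (z :* q :+ b :* q) :* X)
               :+ q :* p :* a :* ((z :+ b :* p) :* Cₙ :+ p :* (z :+ b) :* Aₙ)
               :+ (q :* (z :+ b :* p) :* (p :* a :* Cₙ) :+ q :* p :* (z :+ b) :* (z :* Aₙ)) :=
             q :* (z :+ b :* p) :* ((con 1 :+ b) :* Y :+ p :* a :* Cₙ)
               :+ q :* p :* (z :+ b) :* ((con 1 :+ b) :* X :+ z :* Aₙ)
               :+ q :* p :* a :* ((z :+ b :* p) :* Cₙ :+ p :* (z :+ b) :* Aₙ))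
             refl a q z b p X Y Aₙ Cₙ ⟩
      q * (z + b * p) * ((1# + b) * Y + p * a * Cₙ)
        + q * p * (z + b) * ((1# + b) * X + z * Aₙ)
        + q * p * a * ((z + b * p) * Cₙ + p * (z + b) * Aₙ)
        ≈⟨ +-congʳ (+-cong (*-congˡ (shift-C n)) (*-congˡ (shift-A n))) ⟩
      q * (z + b * p) * (p * ((z + b) * Aₙ + b * Cₙ))
        + q * p * (z + b) * (Aₙ + (1# + a) * Cₙ)
        + q * p * a * ((z + b * p) * Cₙ + p * (z + b) * Aₙ)
        ≈⟨ solve 7 (λ a q z b p Aₙ Cₙ →
             q :* (z :+ b :* p) :* (p :* ((z :+ b) :* Aₙ :+ b :* Cₙ))
               :+ q :* p :* (z :+ b) :* (Aₙ :+ (con 1 :+ a) :* Cₙ)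
               :+ q :* p :* a :* ((z :+ b :* p) :* Cₙ :+ p :* (z :+ b) :* Aₙ) :=
             q :* p :* ((z :+ b) :* ((con 1 :+ a :* p) :* Aₙ :+ (con 1 :+ a) :* Cₙ)
                 :+ b :* ((z :+ b :* p) :* Cₙ :+ p :* (z :+ b) :* Aₙ))
               :+ (q :* (z :+ b :* p) :* (p :* a :* Cₙ) :+ q :* p :* (z :+ b) :* (z :* Aₙ)))
             refl a q z b p Aₙ Cₙ ⟩
      q * p * ((z + b) * ((1# + a * p) * Aₙ + (1# + a) * Cₙ) + b * ((z + b * p) * Cₙ + p * (z + b) * Aₙ))
        + (q * (z + b * p) * (p * a * Cₙ) + q * p * (z + b) * (z * Aₙ)) ∎)
      where
      p  = q ^ suc n
      X  = A z′ b′ n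
      Y  = C z′ b′ n
      Aₙ = A z b n
      Cₙ = C z b n

  ^-vanish : ∀ {x K n} → x ^ K ≈ 0# → K ℕ.≤ n → x ^ n ≈ 0#
  ^-vanish {x} {K} {n} x^K≈0 K≤n = begin
    x ^ n                  ≡⟨ ≡.cong (x ^_) (≡.sym (ℕₚ.m+[n∸m]≡n K≤n)) ⟩
    x ^ (K ℕ.+ (n ∸ K))    ≈⟨ ^-homo-* x K (n ∸ K) ⟩
    x ^ K * x ^ (n ∸ K)    ≈⟨ *-congʳ x^K≈0 ⟩
    0# * x ^ (n ∸ K)       ≈⟨ zeroˡ _ ⟩
    0#                     ∎

  -- `C` starts at `z + b`, and each term of its recurrence carries `C` or `z + b`, so it vanishes.
  -- What remains of the recurrence for `A` multiplies in one factor at a time.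
  vanishing-parameters : ∀ {z b} → z ≈ 0# → b ≈ 0# → ∀ n →
                         A z b n ≈ Π (suc n) (λ i → 1# + a * q ^ i)
  vanishing-parameters {z} {b} z≈0 b≈0 = A≈Π
    where
    z+b≈0 : z + b ≈ 0#
    z+b≈0 = trans (+-cong z≈0 b≈0) (+-identityˡ 0#)

    C≈0 : ∀ n → C z b n ≈ 0#
    C≈0 zero    = z+b≈0
    C≈0 (suc n) = begin
      (z + b * p) * C z b n + p * (z + b) * A z b n ≈⟨ +-cong (*-congˡ (C≈0 n)) (*-congʳ (*-congˡ z+b≈0)) ⟩
      (z + b * p) * 0# + p * 0# * A z b n           ≈⟨ +-cong (zeroʳ _) (trans (*-congʳ (zeroʳ p)) (zeroˡ _)) ⟩
      0# + 0#                                       ≈⟨ +-identityˡ 0# ⟩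
      0#                                            ∎
      where p = q ^ suc n

    A≈Π : ∀ n → A z b n ≈ Π (suc n) (λ i → 1# + a * q ^ i)
    A≈Π zero    = sym (trans (*-identityˡ _) (+-congˡ (*-identityʳ a)))
    A≈Π (suc n) = begin
      (1# + a * p) * A z b n + (1# + a) * C z b n ≈⟨ +-congˡ (trans (*-congˡ (C≈0 n)) (zeroʳ _)) ⟩
      (1# + a * p) * A z b n + 0#                 ≈⟨ +-identityʳ _ ⟩
      (1# + a * p) * A z b n                      ≈⟨ *-comm _ _ ⟩
      A z b n * (1# + a * p)                      ≈⟨ *-congʳ (A≈Π n) ⟩
      Π (suc n) (λ i → 1# + a * q ^ i) * (1# + a * p) ∎
      where p = q ^ suc n

  module _ (K : ℕ) (q^K≈0 : q ^ K ≈ 0#) where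

    -- From index `K` on, the powers of `q` are zero and the recurrence for `C` is multiplication by
    -- `z`; another `K` steps produce the factor `z ^ K`.
    C-vanish : ∀ {z} b → z ^ K ≈ 0# → ∀ {n} → K ℕ.+ K ℕ.≤ n → C z b n ≈ 0#
    C-vanish {z} b z^K≈0 {n} 2K≤n = begin
      C z b n                ≡⟨ ≡.cong (C z b) (≡.sym (ℕₚ.m∸n+n≡m (ℕₚ.m+n≤o⇒n≤o K 2K≤n))) ⟩
      C z b ((n ∸ K) ℕ.+ K)  ≈⟨ C-tail (n ∸ K) ⟩
      z ^ (n ∸ K) * C z b K  ≈⟨ *-congʳ (^-vanish z^K≈0 (ℕₚ.m+n≤o⇒m≤o∸n K 2K≤n)) ⟩
      0# * C z b K           ≈⟨ zeroˡ _ ⟩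
      0#                     ∎
      where
      C-tail : ∀ j → C z b (j ℕ.+ K) ≈ z ^ j * C z b K
      C-tail zero    = sym (*-identityˡ _)
      C-tail (suc j) = begin
        (z + b * p) * Cⱼ + p * (z + b) * Aⱼ ≈⟨ +-cong (*-congʳ (+-congˡ (*-congˡ p≈0))) (*-congʳ (*-congʳ p≈0)) ⟩
        (z + b * 0#) * Cⱼ + 0# * (z + b) * Aⱼ
          ≈⟨ solve 4 (λ z b Cⱼ Aⱼ → (z :+ b :* con 0) :* Cⱼ :+ con 0 :* (z :+ b) :* Aⱼ := z :* Cⱼ)
               refl z b Cⱼ Aⱼ ⟩
        z * Cⱼ                              ≈⟨ *-congˡ (C-tail j) ⟩
        z * (z ^ j * C z b K)               ≈⟨ *-assoc _ _ _ ⟨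
        z ^ suc j * C z b K                 ∎
        where
        p  = q ^ suc (j ℕ.+ K)
        Aⱼ = A z b (j ℕ.+ K)
        Cⱼ = C z b (j ℕ.+ K)
        p≈0 : p ≈ 0#
        p≈0 = ^-vanish q^K≈0 (ℕₚ.m≤n+m K (suc j))

    -- From index `K + K` on, both `C` and the powers of `q` are zero, so the recurrence keeps `A`
    -- constant.
    A-stable : ∀ {z} b → z ^ K ≈ 0# → ∀ d → A z b (d ℕ.+ (K ℕ.+ K)) ≈ A z b (K ℕ.+ K)
    A-stable b z^K≈0 zero    = refl
    A-stable {z} b z^K≈0 (suc d) = begin
      (1# + a * p) * Aₙ + (1# + a) * Cₙ
        ≈⟨ +-cong (*-congʳ (+-congˡ (*-congˡ p≈0))) (*-congˡ (C-vanish b z^K≈0 (ℕₚ.m≤n+m (K ℕ.+ K) d))) ⟩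
      (1# + a * 0#) * Aₙ + (1# + a) * 0#
        ≈⟨ solve 2 (λ a Aₙ → (con 1 :+ a :* con 0) :* Aₙ :+ (con 1 :+ a) :* con 0 := Aₙ) refl a Aₙ ⟩
      Aₙ
        ≈⟨ A-stable b z^K≈0 d ⟩
      A z b (K ℕ.+ K) ∎
      where
      n  = d ℕ.+ (K ℕ.+ K)
      p  = q ^ suc n
      Aₙ = A z b n
      Cₙ = C z b n
      p≈0 : p ≈ 0#
      p≈0 = ^-vanish q^K≈0 (ℕₚ.≤-trans (ℕₚ.m≤m+n K K) (ℕₚ.m≤n+m (K ℕ.+ K) (suc d)))

    -- `g i` stands for `1 / (1 - z qⁱ)`, specified without subtraction. Each shift by `q` releases
    -- one factor `1 + b qⁱ` and one `g i`; after `suc n` shifts both parameters are zero and only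
    -- the factors in `a` remain.
    A-product : ∀ z b → z ^ K ≈ 0# → (g : ℕ → Carrier) → (∀ i → g i ≈ 1# + z * q ^ i * g i) →
                ∀ n → K ℕ.+ K ℕ.≤ n →
                A z b n ≈ (Π (suc n) (λ i → 1# + a * q ^ i) * Π (suc n) (λ i → 1# + b * q ^ i)) * Π (suc n) g
    A-product z b z^K≈0 g g-inv n 2K≤n = begin
      A z b n                       ≈⟨ A-cong (sym (*-identityʳ z)) (sym (*-identityʳ b)) n ⟩
      F 0                           ≈⟨ iterate (suc n) ⟩
      (Πb * Π (suc n) g) * F (suc n) ≈⟨ *-congˡ (vanishing-parameters (small z) (small b) n) ⟩
      (Πb * Π (suc n) g) * Πa       ≈⟨ solve 3 (λ x y w → (x :* y) :* w := (w :* x) :* y) refl _ _ _ ⟩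
      (Πa * Πb) * Π (suc n) g       ∎
      where
      Πa = Π (suc n) (λ i → 1# + a * q ^ i)
      Πb = Π (suc n) (λ i → 1# + b * q ^ i)

      F : ℕ → Carrier
      F k = A (z * q ^ k) (b * q ^ k) n
      small : ∀ x → x * q ^ suc n ≈ 0#
      small x = trans (*-congˡ (^-vanish q^K≈0 (ℕₚ.≤-trans (ℕₚ.m≤m+n K K) (ℕₚ.m≤n⇒m≤1+n 2K≤n)))) (zeroʳ x)

      -- Every shifted `z` is nilpotent with the same exponent, so `C-vanish` applies at each stage.
      scaled^K : ∀ k → (z * q ^ k) ^ K ≈ 0#
      scaled^K k = trans (^-distrib-* z (q ^ k) K) (trans (*-congʳ z^K≈0) (zeroˡ _))

      q-shift : ∀ x k → x * q ^ suc k ≈ x * q ^ k * q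
      q-shift x k = solve 3 (λ x q y → x :* (q :* y) := x :* y :* q) refl x q (q ^ k)

      step : ∀ k → F k ≈ (1# + b * q ^ k) * g k * F (suc k)
      -- Multiplying `shift-A` by `g k` and cancelling this summand takes the place of division by
      -- `1 - zₖ`.
      step k = +-cancelʳ (z * q ^ k * g k * F k) _ _ (begin
        F k + zₖ * g k * F k
          ≈⟨ solve 3 (λ x y w → w :+ x :* y :* w := (con 1 :+ x :* y) :* w) refl zₖ (g k) (F k) ⟩
        (1# + zₖ * g k) * F k
          ≈⟨ *-congʳ (g-inv k) ⟨
        g k * F k
          ≈⟨ *-congˡ (trans (sym (+-identityʳ _)) (+-congˡ (sym (trans (*-congˡ (C-vanish _ (scaled^K k) 2K≤n)) (zeroʳ _))))) ⟩
        g k * (F k + (1# + a) * C zₖ bₖ n)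
          ≈⟨ *-congˡ (shift-A (q-shift z k) (q-shift b k) n) ⟨
        g k * ((1# + bₖ) * F (suc k) + zₖ * F k)
          ≈⟨ solve 5 (λ g b z x y → g :* ((con 1 :+ b) :* x :+ z :* y) :=
               (con 1 :+ b) :* g :* x :+ z :* g :* y) refl (g k) bₖ zₖ (F (suc k)) (F k) ⟩
        (1# + bₖ) * g k * F (suc k) + zₖ * g k * F k ∎)
        where
        zₖ = z * q ^ k
        bₖ = b * q ^ k

      iterate : ∀ k → F 0 ≈ (Π k (λ i → 1# + b * q ^ i) * Π k g) * F k
      iterate zero    = solve 1 (λ x → x := (con 1 :* con 1) :* x) refl (F 0)
      iterate (suc k) = begin
        F 0                                       ≈⟨ iterate k ⟩
        (Pb * Pg) * F k                           ≈⟨ *-congˡ (step k) ⟩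
        (Pb * Pg) * ((1# + b * q ^ k) * g k * F (suc k))
          ≈⟨ solve 5 (λ u v w x y → (u :* v) :* (w :* x :* y) := ((u :* w) :* (v :* x)) :* y) refl
               Pb Pg (1# + b * q ^ k) (g k) (F (suc k)) ⟩
        ((Pb * (1# + b * q ^ k)) * (Pg * g k)) * F (suc k) ∎
        where
        Pb = Π k (λ i → 1# + b * q ^ i)
        Pg = Π k g

-- Listing the members of 𝒟𝒮³ by largest part, and their statistics

module Enumeration where
  open import Data.Nat using (_+_; _*_)
  open ≡ using (refl; sym; trans; cong; subst)
  open Equivalence

  -- No block adds both parts, because 𝒟𝒮³ forbids the pair `3n + 1`, `3n + 2`.
  addNonmultiples : ℕ → List Partition → List Partition
  addNonmultiples n H = (H ++ map (1 + 3 * n ∷_) H) ++ map (2 + 3 * n ∷_) H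

  -- bounded n and bounded′ n list the members of 𝒟𝒮³ with parts at most 3n + 2 and 3n respectively.
  mutual
    bounded bounded′ : ℕ → List Partition
    bounded n = addNonmultiples n (bounded′ n)
    bounded′ zero    = [] ∷ []
    bounded′ (suc n) = bounded n ++ map (3 * suc n ∷_) (bounded n)

  remainder : ∀ r n → (r + 3 * n) % 3 ≡ r % 3
  remainder r n = trans (cong (λ x → (r + x) % 3) (ℕₚ.*-comm 3 n)) ([m+kn]%n≡m%n r n 3)

  remainder-≢ : ∀ {r r′ n n′} → ¬ r % 3 ≡ r′ % 3 → ¬ r + 3 * n ≡ r′ + 3 * n′
  remainder-≢ {r} {r′} {n} {n′} ne p = ne (trans (sym (remainder r n)) (trans (cong (_% 3) p) (remainder r′ n′)))

  DS3-tail : ∀ {p π} → DS3 (p ∷ π) → DS3 π × All (_< p) π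
  DS3-tail {p} {π} ((lk , _ ∷ pos) , ds) with Linked⇒AllPairs (λ x>y y>z → ℕₚ.<-trans y>z x>y) lk
  ... | p>π ∷ _ = ((Linked.tail lk , pos) , λ l (x , y) → ds l (there x , there y)) , p>π

  DS3-cons : ∀ {p π} → 0 < p → DS3 π → All (_< p) π →
             (∀ l → suc (3 * l) ≡ p → 2 + 3 * l ∉ π) → (∀ l → 2 + 3 * l ≡ p → suc (3 * l) ∉ π) →
             DS3 (p ∷ π)
  DS3-cons {p} {π} 0<p ((lk , pos) , ds) π<p no₂ no₁ = (link π<p lk , 0<p ∷ pos) , excluded
    where
    link : ∀ {π} → All (_< p) π → Linked _>_ π → Linked _>_ (p ∷ π)
    link []        _  = [-]
    link (x<p ∷ _) lk = x<p ∷ lk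

    excluded : ∀ l → ¬ (suc (3 * l) ∈ p ∷ π × 2 + 3 * l ∈ p ∷ π)
    excluded l (here x , here y)   = contradiction (trans x (sym y)) (ℕₚ.<⇒≢ ℕₚ.≤-refl)
    excluded l (here x , there y)  = no₂ l x y
    excluded l (there x , here y)  = no₁ l y x
    excluded l (there x , there y) = ds l (x , y)

  record Enumerates (B : ℕ) (L : List Partition) : Set where
    field
      unique  : Unique L
      members : ∀ π → π ∈ L ⇔ (DS3 π × All (_< B) π)
  open Enumerates

  -- When the bound grows by one, the only new members are those with largest part `p`, so it
  -- suffices to know the tails that `p` admits. The old block has all parts below `p`, hence is
  -- disjoint from the new one.
  enumerates-++ : ∀ {p xs ys} → Enumerates p xs → Unique ys → (∀ π → π ∈ ys ⇔ DS3 (p ∷ π)) →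
                  Enumerates (suc p) (xs ++ map (p ∷_) ys)
  enumerates-++ {p} {xs} {ys} enum uniq tails = record
    { unique  = Unique.++⁺ (unique enum) (Unique.map⁺ ∷-injectiveʳ uniq) disjoint
    ; members = λ π → mk⇔ (sound π ∘ ∈-++⁻ xs) (complete π) }
    where
    disjoint : ∀ {π} → ¬ (π ∈ xs × π ∈ map (p ∷_) ys)
    disjoint (π∈xs , π∈map) with ∈-map⁻ (p ∷_) π∈map
    ... | _ , _ , refl with to (members enum _) π∈xs
    ...   | _ , p<p ∷ _ = ℕₚ.<-irrefl refl p<p

    sound : ∀ π → π ∈ xs ⊎ π ∈ map (p ∷_) ys → DS3 π × All (_< suc p) π
    sound π (inj₁ π∈xs) with to (members enum π) π∈xs
    ... | ds , π<p = ds , All.map ℕₚ.m≤n⇒m≤1+n π<p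
    sound π (inj₂ π∈map) with ∈-map⁻ (p ∷_) π∈map
    ... | ρ , ρ∈ys , refl with to (tails ρ) ρ∈ys
    ...   | ds = ds , ℕₚ.≤-refl ∷ All.map ℕₚ.m≤n⇒m≤1+n (proj₂ (DS3-tail ds))

    complete : ∀ π → DS3 π × All (_< suc p) π → π ∈ xs ++ map (p ∷_) ys
    complete []      (ds , _)         = ∈-++⁺ˡ (from (members enum []) (ds , []))
    complete (r ∷ ρ) (ds , s≤s r≤p ∷ _) with ℕₚ.m≤n⇒m<n∨m≡n r≤p
    ... | inj₁ r<p  = ∈-++⁺ˡ (from (members enum (r ∷ ρ))
                        (ds , r<p ∷ All.map (λ x<r → ℕₚ.<-trans x<r r<p) (proj₂ (DS3-tail ds))))
    ... | inj₂ refl = ∈-++⁺ʳ xs (∈-map⁺ (p ∷_) (from (tails ρ) ds))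

  bounded-enumerates  : ∀ n → Enumerates (3 + 3 * n) (bounded n)
  bounded′-enumerates : ∀ n → Enumerates (1 + 3 * n) (bounded′ n)

  bounded-enumerates n = enumerates-++ (enumerates-++ H (unique H) tails₁) (unique H) tails₂
    where
    H = bounded′-enumerates n

    tails₁ : ∀ π → π ∈ bounded′ n ⇔ DS3 (1 + 3 * n ∷ π)
    tails₁ π = mk⇔ (λ π∈ → let ds , π<p = to (members H π) π∈ in
        DS3-cons (s≤s z≤n) ds π<p
          (λ { l e 2∈ → ℕₚ.<⇒≱ (All.lookup π<p 2∈) (ℕₚ.m≤n⇒m≤1+n (ℕₚ.≤-reflexive (sym e))) })
          (λ l e _ → remainder-≢ {2} {1} {l} {n} (λ ()) e))
      (from (members H π) ∘ DS3-tail)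

    tails₂ : ∀ π → π ∈ bounded′ n ⇔ DS3 (2 + 3 * n ∷ π)
    tails₂ π = mk⇔ (λ π∈ → let ds , π<p = to (members H π) π∈ in
        DS3-cons (s≤s z≤n) ds (All.map ℕₚ.m≤n⇒m≤1+n π<p)
          (λ l e _ → remainder-≢ {1} {2} {l} {n} (λ ()) e)
          (λ { l e 1∈ → ℕₚ.<⇒≢ (All.lookup π<p 1∈) (ℕₚ.suc-injective e) }))
      -- Distinctness alone would still allow `3n + 1` below `3n + 2`; the exclusion of that pair
      -- lowers the bound to that of `bounded′ n`.
      (λ ds → let dsπ , π<p = DS3-tail ds in from (members H π) (dsπ , All.tabulate λ x∈π →
        ℕₚ.≤∧≢⇒< (ℕₚ.≤-pred (All.lookup π<p x∈π)) λ { refl → proj₂ ds n (there x∈π , here refl) }))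

  bounded′-enumerates zero = record
    { unique  = [] ∷ []
    ; members = λ π → mk⇔ (λ { (here refl) → (([] , []) , λ { _ (() , _) }) , [] }) λ
        { (_ , []) → here refl ; (((_ , 0<0 ∷ _) , _) , s≤s z≤n ∷ _) → contradiction 0<0 λ () } }
  bounded′-enumerates (suc n) = enumerates-++ P (unique P) λ π →
      mk⇔ (λ π∈ → let ds , π<p = to (members P π) π∈ in
        DS3-cons (s≤s z≤n) ds π<p
          (λ l e _ → remainder-≢ {1} {0} {l} {suc n} (λ ()) e)
          (λ l e _ → remainder-≢ {2} {0} {l} {suc n} (λ ()) e))
        (from (members P π) ∘ DS3-tail)
    where
    P : Enumerates (3 * suc n) (bounded n)
    P = subst (λ B → Enumerates B (bounded n)) (sym (ℕₚ.*-suc 3 n)) (bounded-enumerates n)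

  count-≡ : ∀ i p xs → p % 3 ≡ i → countMod3 i (p ∷ xs) ≡ suc (countMod3 i xs)
  count-≡ i p xs e = cong length (filter-accept (λ p → p % 3 ℕ.≟ i) {x = p} {xs = xs} e)

  count-≢ : ∀ i p xs {j} → p % 3 ≡ j → ¬ j ≡ i → countMod3 i (p ∷ xs) ≡ countMod3 i xs
  count-≢ i p xs e j≢i =
    cong length (filter-reject (λ p → p % 3 ℕ.≟ i) {x = p} {xs = xs} (j≢i ∘ trans (sym e)))

  -- Removing the largest part exchanges odd-indexed and even-indexed parts.
  swap : Mono → Mono
  swap (a , b , c , d , e , f) = b , a , e , f , c , d

  stats-0 : ∀ p π → p % 3 ≡ 0 → stats (p ∷ π) ≡ (p , 0 , 0 , 0 , 0 , 0) ·M swap (stats π)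
  stats-0 p π e =
    Mono-≡ refl refl (count-≢ 1 p (evenParts π) e λ ()) (count-≢ 2 p (evenParts π) e λ ()) refl refl

  stats-1 : ∀ p π → p % 3 ≡ 1 → stats (p ∷ π) ≡ (p , 0 , 1 , 0 , 0 , 0) ·M swap (stats π)
  stats-1 p π e =
    Mono-≡ refl refl (count-≡ 1 p (evenParts π) e) (count-≢ 2 p (evenParts π) e λ ()) refl refl

  stats-2 : ∀ p π → p % 3 ≡ 2 → stats (p ∷ π) ≡ (p , 0 , 0 , 1 , 0 , 0) ·M swap (stats π)
  stats-2 p π e =
    Mono-≡ refl refl (count-≢ 1 p (evenParts π) e λ ()) (count-≡ 2 p (evenParts π) e) refl refl

  X³Y³-power : ∀ n → X³Y³ ^M n ≡ (3 * n , 3 * n , 0 , 0 , 0 , 0)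
  X³Y³-power zero    = refl
  X³Y³-power (suc n) = trans (cong (X³Y³ ·M_) (X³Y³-power n))
    (cong (λ x → x , x , 0 , 0 , 0 , 0) (sym (ℕₚ.*-suc 3 n)))

  module _ (n : ℕ) (π : Partition) where
    private
      3n∷ : ∀ ρ → stats (3 * n ∷ ρ) ≡ (3 * n , 0 , 0 , 0 , 0 , 0) ·M swap (stats ρ)
      3n∷ ρ = stats-0 (3 * n) ρ (remainder 0 n)

      3n∷3n∷ : stats (3 * n ∷ 3 * n ∷ π) ≡ (3 * n , 3 * n , 0 , 0 , 0 , 0) ·M stats π
      3n∷3n∷ = trans (3n∷ (3 * n ∷ π)) (cong (λ s → (3 * n , 0 , 0 , 0 , 0 , 0) ·M swap s) (3n∷ π))

      3n+3∷ : ∀ ρ → stats (3 * suc n ∷ ρ) ≡ (3 + 3 * n , 0 , 0 , 0 , 0 , 0) ·M swap (stats ρ)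
      3n+3∷ ρ = trans (stats-0 (3 * suc n) ρ (remainder 0 (suc n)))
        (cong (λ p → (p , 0 , 0 , 0 , 0 , 0) ·M swap (stats ρ)) (ℕₚ.*-suc 3 n))

    -- The part `3n` is a placeholder: it enters no residue count and already exchanges the odd and
    -- even indices of `π`, so replacing it by `3n + 1` costs exactly `s x`. A list with
    -- placeholders need not be a partition.
    stats-sx : stats (1 + 3 * n ∷ π) ≡ SX ·M stats (3 * n ∷ π)
    stats-sx = trans (stats-1 (1 + 3 * n) π (remainder 1 n)) (cong (SX ·M_) (sym (3n∷ π)))

    stats-tx² : stats (2 + 3 * n ∷ π) ≡ TX² ·M stats (3 * n ∷ π)
    stats-tx² = trans (stats-2 (2 + 3 * n) π (remainder 2 n)) (cong (TX² ·M_) (sym (3n∷ π)))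

    stats-x³ : stats (3 * suc n ∷ π) ≡ X³ ·M stats (3 * n ∷ π)
    stats-x³ = trans (3n+3∷ π) (cong (X³ ·M_) (sym (3n∷ π)))

    -- Two placeholders restore the indexing of `π` and put `3n` into both sums, hence a power of
    -- `x³y³`.
    stats-x³y³ : stats (3 * n ∷ 3 * n ∷ π) ≡ (X³Y³ ^M n) ·M stats π
    stats-x³y³ = trans 3n∷3n∷ (cong (_·M stats π) (sym (X³Y³-power n)))

    -- The second part from the top is even-indexed, so its residue is recorded by `u` and its
    -- excess over `3n` by `y`.
    stats-ux³y : stats (3 * suc n ∷ 1 + 3 * n ∷ π) ≡ UX³Y ·M stats (3 * n ∷ 3 * n ∷ π)
    stats-ux³y = trans (3n+3∷ (1 + 3 * n ∷ π)) (trans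
      (cong (λ s → (3 + 3 * n , 0 , 0 , 0 , 0 , 0) ·M swap s) (stats-1 (1 + 3 * n) π (remainder 1 n)))
      (cong (UX³Y ·M_) (sym 3n∷3n∷)))

    stats-vx³y² : stats (3 * suc n ∷ 2 + 3 * n ∷ π) ≡ VX³Y² ·M stats (3 * n ∷ 3 * n ∷ π)
    stats-vx³y² = trans (3n+3∷ (2 + 3 * n ∷ π)) (trans
      (cong (λ s → (3 + 3 * n , 0 , 0 , 0 , 0 , 0) ·M swap s) (stats-2 (2 + 3 * n) π (remainder 2 n)))
      (cong (VX³Y² ·M_) (sym 3n∷3n∷)))

  parts-≤ : ∀ π → All (_≤ sum (oddParts π) + sum (evenParts π)) π
  parts-≤ []      = []
  parts-≤ (p ∷ ρ) = ℕₚ.≤-trans (ℕₚ.m≤m+n p _) (ℕₚ.m≤m+n _ _) ∷ All.map weaken (parts-≤ ρ)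
    where
    weaken : ∀ {x} → x ≤ sum (oddParts ρ) + sum (evenParts ρ) →
             x ≤ (p + sum (evenParts ρ)) + sum (oddParts ρ)
    weaken x≤ = ℕₚ.≤-trans x≤ (ℕₚ.≤-trans (ℕₚ.≤-reflexive (ℕₚ.+-comm (sum (oddParts ρ)) _))
      (ℕₚ.+-monoˡ-≤ (sum (oddParts ρ)) (ℕₚ.m≤n+m _ p)))

  -- Ensures that some `bounded n` contains every member of 𝒟𝒮³ with prescribed statistics.
  parts-≤-totalDeg : ∀ π → All (_≤ totalDeg (stats π)) π
  parts-≤-totalDeg π = All.map (λ x≤ → ℕₚ.≤-trans x≤
    (ℕₚ.≤-trans (ℕₚ.m≤m+n _ _) (ℕₚ.≤-trans (ℕₚ.m≤m+n _ _) (ℕₚ.≤-trans (ℕₚ.m≤m+n _ _) (ℕₚ.m≤m+n _ _)))))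
    (parts-≤ π)

open Enumeration
open import Data.Integer using (+_)

-- Generating functions of the bounded lists

module WeightedEnumeration {c ℓ} (R : CommutativeRing c ℓ) (τ : Mono → CommutativeRing.Carrier R)
  (τ-1 : CommutativeRing._≈_ R (τ oneM) (CommutativeRing.1# R))
  (τ-· : ∀ k l → CommutativeRing._≈_ R (CommutativeRing._*_ R (τ k) (τ l)) (τ (k ·M l))) where

  open CommutativeRing R
  open Algebra.Solver.Ring.NaturalCoefficients.Default commutativeSemiring using (solve; _:=_; _:+_; _:*_; con)
  open Algebra.Properties.Semiring.Exp semiring using (_^_)
  open Relation.Binary.Reasoning.Setoid setoid

  a b z q : Carrier
  a = τ SX + τ TX²
  b = τ UX³Y + τ VX³Y²
  z = τ X³
  q = τ X³Y³

  open Recurrence R a q using (A; C)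

  τ-^ : ∀ m k → τ (m ^M k) ≈ τ m ^ k
  τ-^ m zero    = τ-1
  τ-^ m (suc k) = trans (sym (τ-· m (m ^M k))) (*-congˡ (τ-^ m k))

  -- The weight is a parameter because the recurrence also needs partitions weighted as if one or
  -- two placeholder parts stood on top.
  genFun : (Partition → Mono) → List Partition → Carrier
  genFun w []      = 0#
  genFun w (π ∷ L) = τ (w π) + genFun w L

  genFun-empty : ∀ w → w [] ≡ oneM → genFun w ([] ∷ []) ≈ 1#
  genFun-empty w w[]≡1 = trans (+-identityʳ _) (trans (reflexive (≡.cong τ w[]≡1)) τ-1)

  genFun-++ : ∀ w xs ys → genFun w (xs ++ ys) ≈ genFun w xs + genFun w ys
  genFun-++ w []       ys = sym (+-identityˡ _)
  genFun-++ w (π ∷ xs) ys = trans (+-congˡ (genFun-++ w xs ys)) (sym (+-assoc _ _ _))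

  genFun-map : ∀ w f L → genFun w (map f L) ≈ genFun (λ π → w (f π)) L
  genFun-map w f []      = refl
  genFun-map w f (π ∷ L) = +-congˡ (genFun-map w f L)

  genFun-scale : ∀ {w v} k L → (∀ π → w π ≡ k ·M v π) → genFun w L ≈ τ k * genFun v L
  genFun-scale k []      eq = sym (zeroʳ _)
  genFun-scale {w} {v} k (π ∷ L) eq = begin
    τ (w π) + genFun w L                         ≡⟨ ≡.cong (λ m → τ m + genFun w L) (eq π) ⟩
    τ (k ·M v π) + genFun w L                    ≈⟨ +-cong (sym (τ-· k (v π))) (genFun-scale k L eq) ⟩
    τ k * τ (v π) + τ k * genFun v L ≈⟨ distribˡ _ _ _ ⟨
    τ k * (τ (v π) + genFun v L)           ∎

  over : ℕ → Partition → Mono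
  over n π = stats (3 ℕ.* n ∷ π)

  over² : ℕ → Partition → Mono
  over² n π = stats (3 ℕ.* n ∷ 3 ℕ.* n ∷ π)

  over²-power : ∀ n L → genFun (over² n) L ≈ q ^ n * genFun stats L
  over²-power n L = trans (genFun-scale (X³Y³ ^M n) L (stats-x³y³ n)) (*-congʳ (τ-^ X³Y³ n))

  genFun-addNonmultiples : ∀ n H → genFun stats (addNonmultiples n H) ≈ genFun stats H + a * genFun (over n) H
  genFun-addNonmultiples n H = begin
    genFun stats (addNonmultiples n H)
      ≈⟨ trans (genFun-++ stats (H ++ _) _) (+-congʳ (genFun-++ stats H _)) ⟩
    (genFun stats H + genFun stats (map (1 ℕ.+ 3 ℕ.* n ∷_) H)) + genFun stats (map (2 ℕ.+ 3 ℕ.* n ∷_) H)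
      ≈⟨ +-cong (+-congˡ (trans (genFun-map stats _ H) (genFun-scale SX H (stats-sx n))))
                (trans (genFun-map stats _ H) (genFun-scale TX² H (stats-tx² n))) ⟩
    (genFun stats H + τ SX * E) + τ TX² * E
      ≈⟨ solve 4 (λ h s t e → (h :+ s :* e) :+ t :* e := h :+ (s :+ t) :* e) refl _ _ _ _ ⟩
    genFun stats H + a * E ∎
    where E = genFun (over n) H

  -- Under a top part `3n + 3`, an inserted `3n + 1` or `3n + 2` is even-indexed. This gives the
  -- factor `b`, and the two top parts are measured against two placeholders, which contribute
  -- `q ^ n`.
  genFun-over-addNonmultiples : ∀ n H → genFun (over (suc n)) (addNonmultiples n H) ≈ z * genFun (over n) H + b * (q ^ n * genFun stats H)
  genFun-over-addNonmultiples n H = begin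
    genFun (over (suc n)) (addNonmultiples n H)
      ≈⟨ trans (genFun-++ (over (suc n)) (H ++ _) _) (+-congʳ (genFun-++ (over (suc n)) H _)) ⟩
    (genFun (over (suc n)) H + genFun (over (suc n)) (map (1 ℕ.+ 3 ℕ.* n ∷_) H))
      + genFun (over (suc n)) (map (2 ℕ.+ 3 ℕ.* n ∷_) H)
      ≈⟨ +-cong (+-cong (genFun-scale X³ H (stats-x³ n))
                  (trans (genFun-map (over (suc n)) _ H) (genFun-scale UX³Y H (stats-ux³y n))))
                (trans (genFun-map (over (suc n)) _ H) (genFun-scale VX³Y² H (stats-vx³y² n))) ⟩
    (z * E + τ UX³Y * E²) + τ VX³Y² * E²
      ≈⟨ solve 5 (λ z e u v f → (z :* e :+ u :* f) :+ v :* f := z :* e :+ (u :+ v) :* f) refl _ _ _ _ _ ⟩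
    z * E + b * E²
      ≈⟨ +-congˡ (*-congˡ (over²-power n H)) ⟩
    z * E + b * (q ^ n * genFun stats H) ∎
    where
    E  = genFun (over n) H
    E² = genFun (over² n) H

  -- The four claims follow the recursion of `bounded` and `bounded′`. When `3n + 3` is placed over
  -- `bounded′ (suc n)`, partitions without that part give `C`; those with it get a doubled
  -- `3n + 3`, hence `q ^ suc n` times `A`.
  genFun-bounded : ∀ n → genFun stats (bounded n) ≈ A z b n
  genFun-over    : ∀ n → genFun (over (suc n)) (bounded n) ≈ C z b n
  genFun-bounded′ : ∀ n → genFun stats (bounded′ (suc n)) ≈ A z b n + C z b n
  genFun-over′    : ∀ n → genFun (over (suc n)) (bounded′ (suc n)) ≈ C z b n + q ^ suc n * A z b n

  genFun-bounded zero = trans (genFun-addNonmultiples 0 ([] ∷ []))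
    (+-cong (genFun-empty stats ≡.refl) (trans (*-congˡ (genFun-empty (over 0) ≡.refl)) (*-identityʳ a)))
  genFun-bounded (suc n) = begin
    genFun stats (bounded (suc n))
      ≈⟨ genFun-addNonmultiples (suc n) (bounded′ (suc n)) ⟩
    genFun stats (bounded′ (suc n)) + a * genFun (over (suc n)) (bounded′ (suc n))
      ≈⟨ +-cong (genFun-bounded′ n) (*-congˡ (genFun-over′ n)) ⟩
    (A z b n + C z b n) + a * (C z b n + q ^ suc n * A z b n)
      ≈⟨ solve 4 (λ a p x y → (x :+ y) :+ a :* (y :+ p :* x) :=
           (con 1 :+ a :* p) :* x :+ (con 1 :+ a) :* y) refl a (q ^ suc n) (A z b n) (C z b n) ⟩
    A z b (suc n) ∎

  genFun-over zero = trans (genFun-over-addNonmultiples 0 ([] ∷ []))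
    (+-cong (trans (*-congˡ (genFun-empty (over 0) ≡.refl)) (*-identityʳ z))
            (trans (*-congˡ (trans (*-identityˡ _) (genFun-empty stats ≡.refl))) (*-identityʳ b)))
  genFun-over (suc n) = begin
    genFun (over (suc (suc n))) (bounded (suc n))
      ≈⟨ genFun-over-addNonmultiples (suc n) (bounded′ (suc n)) ⟩
    z * genFun (over (suc n)) (bounded′ (suc n)) + b * (q ^ suc n * genFun stats (bounded′ (suc n)))
      ≈⟨ +-cong (*-congˡ (genFun-over′ n)) (*-congˡ (*-congˡ (genFun-bounded′ n))) ⟩
    z * (C z b n + q ^ suc n * A z b n) + b * (q ^ suc n * (A z b n + C z b n))
      ≈⟨ solve 5 (λ z b p x y → z :* (y :+ p :* x) :+ b :* (p :* (x :+ y)) :=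
           (z :+ b :* p) :* y :+ p :* (z :+ b) :* x) refl z b (q ^ suc n) (A z b n) (C z b n) ⟩
    C z b (suc n) ∎

  genFun-bounded′ n = trans (genFun-++ stats (bounded n) _)
    (+-cong (genFun-bounded n) (trans (genFun-map stats _ (bounded n)) (genFun-over n)))
  genFun-over′ n = trans (genFun-++ (over (suc n)) (bounded n) _)
    (+-cong (genFun-over n) (trans (genFun-map (over (suc n)) _ (bounded n))
      (trans (over²-power (suc n) (bounded n)) (*-congˡ (genFun-bounded n)))))

-- The partial products modulo degree `D`

module InfiniteProduct (D : ℕ) where
  open Truncated D using (pointwise; term-⊛; term-small) renaming (ring to R)
  open CommutativeRing R
  open Algebra.Properties.Semiring.Exp semiring using (_^_)
  open Algebra.Properties.Ring (CommutativeRing.ring R) using (-‿distribˡ-*; -‿involutive)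
  open Relation.Binary.Reasoning.Setoid setoid
  open WeightedEnumeration R (term 1ℤ) refl term-⊛
  open Recurrence R a q

  genFun-count : ∀ m L → genFun stats L m ≡ + length (filter (λ π → stats π ≟M m) L)
  genFun-count m []      = ≡.refl
  genFun-count m (π ∷ L) with stats π ≟M m
  ... | yes _ = ≡.cong (ℤ._+_ 1ℤ) (genFun-count m L)
  ... | no  _ = ≡.trans (ℤₚ.+-identityˡ _) (genFun-count m L)

  prodBelow-Π : ∀ {F G} → (∀ i → F i ≈ G i) → ∀ n → prodBelow n F ≈ Π n G
  prodBelow-Π F≈G zero    = refl
  prodBelow-Π F≈G (suc n) = *-cong (prodBelow-Π F≈G n) (F≈G n)

  -- `aSeries` and `bSeries` carry a minus sign, which cancels the one in `poch`.
  poch-Π : ∀ c n → poch (neg c) X³Y³ n ≈ Π n (λ i → 1# + c * q ^ i)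
  poch-Π c = prodBelow-Π λ i → +-congˡ {one} (begin
    - (- c * term 1ℤ (X³Y³ ^M i))   ≈⟨ -‿cong (-‿distribˡ-* c _) ⟨
    - (- (c * term 1ℤ (X³Y³ ^M i))) ≈⟨ -‿involutive _ ⟩
    c * term 1ℤ (X³Y³ ^M i)         ≈⟨ *-congˡ {c} (τ-^ X³Y³ i) ⟩
    c * q ^ i                       ∎)

  geom-inverse : ∀ i → geom (X³ ·M (X³Y³ ^M i)) ≈ 1# + z * q ^ i * geom (X³ ·M (X³Y³ ^M i))
  geom-inverse i = begin
    geom m                      ≈⟨ pointwise (geom-unfold m (s≤s z≤n)) ⟩
    1# + term 1ℤ m * geom m     ≈⟨ +-congˡ {1#} (*-congʳ {geom m}
      (trans (sym (term-⊛ X³ (X³Y³ ^M i))) (*-congˡ {z} (τ-^ X³Y³ i)))) ⟩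
    1# + z * q ^ i * geom m     ∎
    where m = X³ ·M (X³Y³ ^M i)

  -- The `D`-th power has total degree at least `D`, so it is zero after truncation; this supplies
  -- the nilpotency of `z` and `q`.
  power-vanish : ∀ m → .{{ℕ.NonZero (totalDeg m)}} → term 1ℤ m ^ D ≈ 0#
  power-vanish m = trans (sym (τ-^ m D)) (term-small (m ^M D)
    (≡.subst (D ≤_) (≡.sym (totalDeg-^ m D)) (ℕₚ.m≤m*n D (totalDeg m))))

  rhsPartial-bounded : ∀ N → suc (D ℕ.+ D) ≤ N → rhsPartial N ≈ genFun stats (bounded (D ℕ.+ D))
  rhsPartial-bounded (suc n) (s≤s 2D≤n) = begin
    rhsPartial (suc n)
      ≈⟨ *-cong (*-cong (poch-Π a (suc n)) (poch-Π b (suc n))) (prodBelow-Π (λ _ → refl) (suc n)) ⟩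
    (Π (suc n) (λ i → 1# + a * q ^ i) * Π (suc n) (λ i → 1# + b * q ^ i))
      * Π (suc n) (λ i → geom (X³ ·M (X³Y³ ^M i)))
      ≈⟨ A-product D (power-vanish X³Y³) z b (power-vanish X³) _ geom-inverse n 2D≤n ⟨
    A z b n
      -- A product of `suc n` factors matches index `n` of `A`; stability lowers this index to
      -- `D + D`, which does not depend on `N`.
      ≡⟨ ≡.cong (A z b) (≡.sym (ℕₚ.m∸n+n≡m 2D≤n)) ⟩
    A z b ((n ℕ.∸ (D ℕ.+ D)) ℕ.+ (D ℕ.+ D))
      ≈⟨ A-stable D (power-vanish X³Y³) b (power-vanish X³) (n ℕ.∸ (D ℕ.+ D)) ⟩
    A z b (D ℕ.+ D)
      ≈⟨ genFun-bounded (D ℕ.+ D) ⟨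
    genFun stats (bounded (D ℕ.+ D)) ∎

theorem3p4 : (m : Mono) →
    Σ (List Partition) λ L →
    Unique L
    × ((π : Partition) → (π ∈ L) ⇔ (DS3 π × stats π ≡ m))
    × ∃[ N₀ ] ((N : ℕ) → N₀ ≤ N → rhsPartial N m ≡ + length L)
theorem3p4 m = filter (λ π → stats π ≟M m) (bounded n)
  , Unique.filter⁺ (λ π → stats π ≟M m) (unique enum)
  , (λ π → mk⇔ (sound π) (complete π))
  , suc n
  , (λ N N₀≤N → ≡.trans (at (InfiniteProduct.rhsPartial-bounded D N N₀≤N) m ℕₚ.≤-refl)
                       (InfiniteProduct.genFun-count D m (bounded n)))
  where
  open Enumerates
  open Equivalence
  open Truncated using (at)

  -- The successor puts `m` itself below the truncation degree, so that the congruence can be read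
  -- off at `m`.
  D = suc (totalDeg m)
  n = D ℕ.+ D
  enum = bounded-enumerates n

  sound : ∀ π → π ∈ filter (λ π → stats π ≟M m) (bounded n) → DS3 π × stats π ≡ m
  sound π π∈ with ∈-filter⁻ (λ π → stats π ≟M m) {xs = bounded n} π∈
  ... | π∈bounded , eq = proj₁ (to (members enum π) π∈bounded) , eq

  complete : ∀ π → DS3 π × stats π ≡ m → π ∈ filter (λ π → stats π ≟M m) (bounded n)
  complete π (ds , ≡.refl) = ∈-filter⁺ (λ π → stats π ≟M m)
    (from (members enum π) (ds , All.map (λ x≤ → ℕₚ.≤-trans (s≤s x≤) D≤bound) (parts-≤-totalDeg π))) ≡.refl
    where
    -- Each part is at most `totalDeg m`, hence below `D`, and the bound for `bounded n` is at least
    -- `D`.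
    D≤bound : D ≤ 3 ℕ.+ 3 ℕ.* n
    D≤bound = ℕₚ.≤-trans (ℕₚ.m≤m+n D D) (ℕₚ.≤-trans (ℕₚ.m≤n*m n 3) (ℕₚ.m≤n+m (3 ℕ.* n) 3))
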